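{- Let $H$ be a nontrivial finite group of odd order and let $G=\mathbb{Z}_2\times H$. Then $G$ is doubly R-sequenceable, i.e. there exists a sequence $g_1,\dots,g_m$ (with $m=2(|G|-1)$) in which every element of $G\setminus\{1_G\}$ occurs exactly twice, such that the sequence $g_m^{ -1}g_1,\ g_1^{ -1}g_2,\ g_2^{ -1}g_3,\ \dots,\ g_{m-1}^{ -1}g_m$ also contains every element of $G\setminus\{1_G\}$ exactly twice.
   Context: For a subset $A$ of a finite group, $\mathcal{P}_k(A)$ denotes the set of finite sequences of elements of $A$ containing every element of $A$ exactly $k$ times. For a sequence $g_1,\dots,g_m$ set $g_0=g_m$ and $\bar g_i=g_{i-1}^{ -1}g_i$ ($1\le i\le m$); $\check{\mathbf g}$ denotes the sequence $\bar g_1,\dots,\bar g_m$. A set $A$ is doubly R-sequenceable if there is $\mathbf g\in\mathcal P_2(A\setminus\{1_G\})$ with $\check{\mathbf g}\in\mathcal P_2(A\setminus\{1_G\})$; a group is doubly R-sequenceable if its underlying set is. -}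

module Defs where

open import Data.Nat using (ℕ; zero; suc; _+_)
open import Data.Bool using (Bool; true; false; _xor_)
open import Data.Fin using (Fin)
open import Data.Product using (_×_; _,_)
open import Data.List using (List; []; _∷_; zipWith)
open import Relation.Binary.PropositionalEquality using (_≡_; _≢_)
open import Relation.Binary.Definitions using (DecidableEquality)
open import Relation.Nullary using (yes; no)
open import Algebra.Structures using (IsGroup)
import Data.Product
import Data.Product.Properties
import Data.Bool
import Data.Fin

occ : {C : Set} → DecidableEquality C → C → List C → ℕ
occ _≟_ x [] = 0
occ _≟_ x (y ∷ ys) with x ≟ y
... | yes _ = suc (occ _≟_ x ys)
... | no  _ = occ _≟_ x ys

lastOf : {C : Set} → C → List C → C
lastOf x [] = x
lastOf x (y ∷ ys) = lastOf y ys

check : {C : Set} → (C → C → C) → (C → C) → List C → List C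
check _∙_ _⁻¹ [] = []
check _∙_ _⁻¹ (x ∷ xs) =
  zipWith (λ a b → (a ⁻¹) ∙ b) (lastOf x xs ∷ x ∷ xs) (x ∷ xs)

InP2∖1 : {C : Set} → DecidableEquality C → C → List C → Set
InP2∖1 {C} _≟_ ε gs =
  (occ _≟_ ε gs ≡ 0) × (∀ (x : C) → x ≢ ε → occ _≟_ x gs ≡ 2)

DoublyRSequenceable : {C : Set} → DecidableEquality C →
  (C → C → C) → C → (C → C) → Set
DoublyRSequenceable {C} _≟_ _∙_ ε _⁻¹ =
  Data.Product.Σ (List C) λ gs →
    InP2∖1 _≟_ ε gs × InP2∖1 _≟_ ε (check _∙_ _⁻¹ gs)

record FinGroup (n : ℕ) : Set where
  field
    _∙_ : Fin n → Fin n → Fin n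
    ε   : Fin n
    _⁻¹ : Fin n → Fin n
    isGroup : IsGroup _≡_ _∙_ ε _⁻¹

module Z2× {n : ℕ} (H : FinGroup n) where
  open FinGroup H renaming (_∙_ to _·_; ε to e; _⁻¹ to inv)

  Carrier : Set
  Carrier = Bool × Fin n

  _≟G_ : DecidableEquality Carrier
  _≟G_ = Data.Product.Properties.≡-dec Data.Bool._≟_ Data.Fin._≟_

  _∙_ : Carrier → Carrier → Carrier
  (a , h) ∙ (b , k) = (a xor b , h · k)

  ε : Carrier
  ε = (false , e)

  _⁻¹ : Carrier → Carrier
  (a , h) ⁻¹ = (a , inv h)

Odd : ℕ → Set
Odd n = Data.Product.Σ ℕ λ k → n ≡ suc (k + k)

{-# OPTIONS --safe #-}

-- Call a permutation ν of a finite group K harmonious if ν is a single cycle and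
-- v ↦ v⁻¹ ν(v)² is injective.  Every finite group has one, by induction along a chain of
-- subgroups M ⊆ ⟨ M , z ⟩: list representatives d₀ = 1 , … , d_{N-1} of the right cosets of M
-- cyclically so that each d_j⁻¹ d_{j+1} lies in z M (an Eulerian circuit argument on the double
-- cosets of M), send m d_j to m d_{j+1}, and m d_{N-1} to ν(m).
--
-- In a group H of odd order squaring is bijective.  The edges s → s² , s → ν(s)² and
-- s → s p⁻¹ s with p = ν(1), distributed over the two copies of H in ℤ₂ × H, give a digraph in
-- which every element is twice a source, twice a target and twice the quotient of an edge.
-- Exchanging four targets cyclically turns the two edges leaving the identity into loops, and
-- then the rest is connected because ν is a single cycle.  An Eulerian circuit of it is the
-- required sequence.

module Submission where

open import Defs
open import Algebra.Bundles using (Group)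
import Algebra.Properties.Group as GroupProperties
open import Data.Bool using (Bool; true; false; _xor_; if_then_else_)
import Data.Bool.Properties as Bool
open import Data.Empty using (⊥-elim)
open import Data.Fin using (Fin)
import Data.Fin as Fin using (zero; suc)
import Data.Fin.Properties as Fin
open import Data.List using (List; []; _∷_; _++_; length; map; allFin; cartesianProduct; zipWith)
open import Data.List.Membership.Propositional using (_∈_; _∉_; find; lose)
open import Data.List.Membership.Propositional.Properties
  using (∈-∃++; ∈-map⁻; ∈-allFin; ∈-cartesianProduct⁺)
open import Data.List.Properties using (length-++; length-map; length-tabulate)
open import Data.List.Relation.Binary.Permutation.Propositional
  using (_↭_; prep; swap; ↭-refl; ↭-reflexive; ↭-sym; ↭-trans; ↭⇒↭ₛ)
import Data.List.Relation.Binary.Permutation.Propositional as ↭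
open import Data.List.Relation.Binary.Permutation.Propositional.Properties
  using (Any-resp-↭; ↭-length; map⁺; shift; ++-identityʳ)
import Data.List.Relation.Binary.Permutation.Setoid.Properties as ↭ₛ
open import Data.List.Relation.Binary.Subset.Propositional using (_⊆_)
open import Data.List.Relation.Unary.All as All using (All; []; _∷_)
open import Data.List.Relation.Unary.All.Properties using (¬Any⇒All¬)
open import Data.List.Relation.Unary.AllPairs as AllPairs using (AllPairs; []; _∷_)
import Data.List.Relation.Unary.AllPairs.Properties as AllPairs
open import Data.List.Relation.Unary.Any as Any using (Any; here; there; any?)
open import Data.List.Relation.Unary.Any.Properties using (++⁺ˡ; ++⁺ʳ; ++⁻)
open import Data.List.Relation.Unary.Unique.Propositional using (Unique)
import Data.List.Relation.Unary.Unique.Propositional.Properties as Unique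
open import Data.Nat using (ℕ; zero; suc; _+_; _∸_; _≤_; _<_; z≤n; s≤s)
open import Data.Nat.Properties
  using (≤-refl; ≤-trans; ≤-reflexive; ≤-antisym; ≤-pred; <-irrefl; <⇒≤; ≮⇒≥; _<?_; n≤1+n; m≤m+n;
         m≤n+m; m≤n⇒m<n∨m≡n; m+[n∸m]≡n; +-assoc; +-comm; +-suc; +-monoʳ-≤; suc-injective;
         anyUpTo?; module ≤-Reasoning)
open import Data.Product using (Σ; ∃; _×_; _,_; proj₁; proj₂)
open import Data.Product.Properties using (≡-dec)
open import Data.Sum using (_⊎_; inj₁; inj₂)
open import Function using (_∘_; id)
open import Level using (0ℓ)
open import Relation.Binary using (IsDecEquivalence; DecidableEquality)
open import Relation.Binary.PropositionalEquality
  using (_≡_; _≢_; refl; sym; trans; cong; subst; setoid; isDecEquivalence; module ≡-Reasoning)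
open import Relation.Nullary using (¬_; Dec; yes; no; does; contradiction)
open import Relation.Nullary.Decidable using (_×-dec_; ¬?; dec-true; dec-false; decidable-stable)

-- Lists and natural numbers

unique⊆⇒length≤ : {A : Set} {xs ys : List A} → Unique xs → xs ⊆ ys → length xs ≤ length ys
unique⊆⇒length≤ [] _ = z≤n
unique⊆⇒length≤ {xs = x ∷ xs} (x∉xs ∷ xs!) xs⊆ys with ∈-∃++ (xs⊆ys (here refl))
... | as , bs , refl = begin
  suc (length xs)             ≤⟨ s≤s (unique⊆⇒length≤ xs! xs⊆as++bs) ⟩
  suc (length (as ++ bs))     ≡⟨ ↭-length (shift x as bs) ⟨
  length (as ++ x ∷ bs)       ∎
  where
  open ≤-Reasoning
  xs⊆as++bs : xs ⊆ as ++ bs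
  xs⊆as++bs {y} y∈xs with Any-resp-↭ (shift x as bs) (xs⊆ys (there y∈xs))
  ... | here refl = contradiction refl (All.lookup x∉xs y∈xs)
  ... | there y∈ = y∈

unique⊆⇒⊇ : {A : Set} → DecidableEquality A → {xs ys : List A} → Unique xs → xs ⊆ ys →
  length ys ≤ length xs → ys ⊆ xs
unique⊆⇒⊇ _≟_ {xs} {ys} xs! xs⊆ys ∣ys∣≤∣xs∣ {y} y∈ys with any? (y ≟_) xs
... | yes y∈xs = y∈xs
... | no y∉xs = ⊥-elim (<-irrefl refl
  (≤-trans (unique⊆⇒length≤ (¬Any⇒All¬ xs y∉xs ∷ xs!) y∷xs⊆ys) ∣ys∣≤∣xs∣))
  where
  y∷xs⊆ys : (y ∷ xs) ⊆ ys
  y∷xs⊆ys (here refl) = y∈ys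
  y∷xs⊆ys (there x∈xs) = xs⊆ys x∈xs

least : {P : ℕ → Set} → (∀ i → Dec (P i)) → ∀ n →
  (∃ λ k → P k × (∀ {i} → i < k → ¬ P i)) ⊎ (∀ {i} → i < n → ¬ P i)
least P? zero = inj₂ λ ()
least P? (suc n) with least P? n
... | inj₁ found = inj₁ found
... | inj₂ none with P? n
...   | yes pn = inj₁ (n , pn , none)
...   | no ¬pn = inj₂ λ i<1+n → case (m≤n⇒m<n∨m≡n (≤-pred i<1+n))
  where
  case : ∀ {i} → i < n ⊎ i ≡ n → ¬ _
  case (inj₁ i<n) = none i<n
  case (inj₂ refl) = ¬pn

-- Eulerian circuits

-- Think of the elements of E as the edges of a digraph: f sends an edge to some edge leaving
-- its head, and ≈ relates the edges with a common tail.  A circuit is then an Eulerian circuit.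
-- It is obtained by splicing f-orbits into each other.
module Circuits {E : Set} (edges : List E) (complete : ∀ e → e ∈ edges)
  {_∼_ _≈_ : E → E → Set} (∼-isDecEquivalence : IsDecEquivalence _∼_)
  (≈-isDecEquivalence : IsDecEquivalence _≈_) (∼⇒≈ : ∀ {a b} → a ∼ b → a ≈ b)
  (f : E → E) (f-cong : ∀ {a b} → a ∼ b → f a ∼ f b) (f-injective : ∀ {a b} → f a ∼ f b → a ∼ b)
  where

  private
    module ∼ = IsDecEquivalence ∼-isDecEquivalence
    module ≈ = IsDecEquivalence ≈-isDecEquivalence

  _≁_ : E → E → Set
  a ≁ b = ¬ a ∼ b

  _∈∼_ : E → List E → Set
  a ∈∼ xs = Any (a ∼_) xs

  -- Consecutive edges are linked by `≈` only: any edge leaving the head may follow, not just the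
  -- `f`-image. This freedom is what allows splicing.
  Path : E → List E → E → Set
  Path a [] b = f a ≈ b
  Path a (x ∷ xs) b = f a ≈ x × Path x xs b

  iter : ℕ → E → E
  iter zero b = b
  iter (suc k) b = iter k (f b)

  orbit⁺ : ℕ → E → List E
  orbit⁺ zero b = []
  orbit⁺ (suc k) b = f b ∷ orbit⁺ k (f b)

  orbit : ℕ → E → List E
  orbit k b = b ∷ orbit⁺ k b

  iter-f : ∀ k b → iter k (f b) ≡ f (iter k b)
  iter-f zero b = refl
  iter-f (suc k) b = iter-f k (f b)

  iter-+ : ∀ i j b → iter j (iter i b) ≡ iter (i + j) b
  iter-+ zero j b = refl
  iter-+ (suc i) j b = iter-+ i j (f b)

  length-orbit : ∀ k b → length (orbit k b) ≡ suc k
  length-orbit zero b = refl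
  length-orbit (suc k) b = cong suc (length-orbit k (f b))

  orbit-all : ∀ {P : E → Set} k b → (∀ {i} → i < suc k → P (iter i b)) → All P (orbit k b)
  orbit-all zero b p = p (s≤s z≤n) ∷ []
  orbit-all (suc k) b p = p (s≤s z≤n) ∷ orbit-all k (f b) (p ∘ s≤s)

  -- Injectivity of `f` pulls a coincidence between two later terms back to a return to `b`.
  orbit-distinct : ∀ k b → (∀ {i} → i < k → ¬ iter (suc i) b ∼ b) → AllPairs _≁_ (orbit k b)
  orbit-distinct zero b _ = [] ∷ []
  orbit-distinct (suc k) b noReturn =
    orbit-all k (f b) (λ i<1+k → noReturn i<1+k ∘ ∼.sym) ∷
    orbit-distinct k (f b) λ {i} i<k r →
      noReturn (≤-trans i<k (n≤1+n k)) (f-injective (subst (_∼ f b) (iter-f (suc i) b) r))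

  distinct⇒length≤ : ∀ {xs} → AllPairs _≁_ xs → length xs ≤ length edges
  distinct⇒length≤ xs! =
    unique⊆⇒length≤ (AllPairs.map (λ { a≁b refl → a≁b ∼.refl }) xs!) (λ {e} _ → complete e)

  -- Without a return within `length edges` steps, the orbit would contain one more distinct edge
  -- than there are edges.
  firstReturn : ∀ b → ∃ λ k → iter (suc k) b ∼ b × (∀ {i} → i < k → ¬ iter (suc i) b ∼ b)
  firstReturn b with least (λ i → iter (suc i) b ∼.≟ b) (length edges)
  ... | inj₁ found = found
  ... | inj₂ none = ⊥-elim (<-irrefl refl (subst (_≤ length edges) (length-orbit (length edges) b)
          (distinct⇒length≤ (orbit-distinct (length edges) b none))))

  orbit⁺-path : ∀ k b {c} → iter (suc k) b ≈ c → Path b (orbit⁺ k b) c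
  orbit⁺-path zero b r = r
  orbit⁺-path (suc k) b r = ≈.refl , orbit⁺-path k (f b) r

  orbit-f : ∀ k b {x} → x ∈∼ orbit k b → f x ∈∼ orbit k b ⊎ f x ∼ iter (suc k) b
  orbit-f zero b (here x∼b) = inj₂ (f-cong x∼b)
  orbit-f (suc k) b (here x∼b) = inj₁ (there (here (f-cong x∼b)))
  orbit-f (suc k) b (there x∈) with orbit-f k (f b) x∈
  ... | inj₁ fx∈ = inj₁ (there fx∈)
  ... | inj₂ fx∼ = inj₂ fx∼

  orbit-closed : ∀ k {b x} → iter (suc k) b ∼ b → x ∈∼ orbit k b → f x ∈∼ orbit k b
  orbit-closed k {b} r x∈ with orbit-f k b x∈
  ... | inj₁ fx∈ = fx∈
  ... | inj₂ fx∼ = here (∼.trans fx∼ r)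

  path-++ : ∀ {a} xs {b} ys {c} → Path a xs b → Path b ys c → Path a (xs ++ b ∷ ys) c
  path-++ [] ys p q = p , q
  path-++ (x ∷ xs) ys (s , p) q = s , path-++ xs ys p q

  -- The loop goes in just before `c`, or at the end of the path when `c` is `b`. It must be
  -- enterable from every `w` whose head is the tail of `c`, because the edge preceding `c` is
  -- arbitrary.
  splice : ∀ {a} xs {b c} os → Path a xs b → c ∈ b ∷ xs →
    (∀ w → f w ≈ c → Path w os c) → ∃ λ zs → Path a zs b × zs ↭ os ++ xs
  splice [] os p (here refl) loop =
    os , loop _ p , ↭-sym (++-identityʳ os)
  splice (x ∷ xs) os (s , p) (there (here refl)) loop =
    os ++ x ∷ xs , path-++ os xs (loop _ s) p , ↭-refl
  splice (x ∷ xs) os (s , p) (here c≡b) loop with splice xs os p (here c≡b) loop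
  ... | zs , q , zs↭ = x ∷ zs , (s , q) , ↭-trans (prep x zs↭) (↭-sym (shift x os xs))
  splice (x ∷ xs) os (s , p) (there (there c∈xs)) loop with splice xs os p (there c∈xs) loop
  ... | zs , q , zs↭ = x ∷ zs , (s , q) , ↭-trans (prep x zs↭) (↭-sym (shift x os xs))

  -- `f-closed` keeps the edge set a union of whole `f`-orbits, so that a further orbit either lies
  -- in it or is disjoint from it.
  record ClosedPath (a : E) : Set where
    field
      rest : List E
      path : Path a rest a
      distinct : AllPairs _≁_ (a ∷ rest)
      f-closed : ∀ {x} → x ∈∼ (a ∷ rest) → f x ∈∼ (a ∷ rest)

  orbitPath : ∀ a → ClosedPath a
  orbitPath a with firstReturn a
  ... | k , r , noReturn = record
    { rest = orbit⁺ k a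
    ; path = orbit⁺-path k a (∼⇒≈ r)
    ; distinct = orbit-distinct k a noReturn
    ; f-closed = orbit-closed k r
    }

  extend : ∀ {a} (C : ClosedPath a) → let open ClosedPath C in
    ∀ {c b} → c ∈ a ∷ rest → c ≈ b → ¬ b ∈∼ (a ∷ rest) →
    Σ (ClosedPath a) λ C′ → length rest < length (ClosedPath.rest C′)
  extend {a} C {c} {b} c∈ c≈b b∉ with firstReturn b
  ... | k , r , noReturn with splice rest (orbit k b) path c∈
          (λ w fw≈c → ≈.trans fw≈c c≈b , orbit⁺-path k b (≈.trans (∼⇒≈ r) (≈.sym c≈b)))
    where open ClosedPath C
  ...   | zs , q , zs↭ = record
    { rest = zs
    ; path = q
    ; distinct = ↭ₛ.AllPairs-resp-↭ (setoid E) (_∘ ∼.sym) (subst (_ ≁_) , subst (_≁ _)) (↭⇒↭ₛ (↭-sym new↭))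
        (AllPairs.++⁺ (orbit-distinct k b noReturn) distinct
          (orbit-all k b λ i<1+k → ¬Any⇒All¬ _ (fresh i<1+k)))
    ; f-closed = Any-resp-↭ (↭-sym new↭) ∘ closed ∘ ++⁻ (orbit k b) ∘ Any-resp-↭ new↭
    } , longer
    where
    open ClosedPath C
    new↭ : a ∷ zs ↭ orbit k b ++ a ∷ rest
    new↭ = ↭-trans (prep a zs↭) (↭-sym (shift a (orbit k b) rest))
    iter∈ : ∀ j {x} → x ∈∼ (a ∷ rest) → iter j x ∈∼ (a ∷ rest)
    iter∈ zero x∈ = x∈
    iter∈ (suc j) x∈ = iter∈ j (f-closed x∈)
    -- An orbit that met the path would stay on it up to the return to `b`, which would put `b` on
    -- the path.
    fresh : ∀ {i} → i < suc k → ¬ iter i b ∈∼ (a ∷ rest)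
    fresh {i} i<1+k x∈ = b∉ (Any.map (∼.trans (∼.sym r))
      (subst (_∈∼ (a ∷ rest))
        (trans (iter-+ i (suc k ∸ i) b) (cong (λ j → iter j b) (m+[n∸m]≡n (<⇒≤ i<1+k))))
        (iter∈ (suc k ∸ i) x∈)))
    closed : ∀ {x} → x ∈∼ orbit k b ⊎ x ∈∼ (a ∷ rest) → f x ∈∼ (orbit k b ++ a ∷ rest)
    closed (inj₁ x∈) = ++⁺ˡ (orbit-closed k r x∈)
    closed (inj₂ x∈) = ++⁺ʳ (orbit k b) (f-closed x∈)
    longer : length rest < length zs
    longer = begin
      suc (length rest)                     ≤⟨ s≤s (m≤n+m (length rest) k) ⟩
      suc k + length rest                   ≡⟨ cong (_+ length rest) (length-orbit k b) ⟨
      length (orbit k b) + length rest      ≡⟨ length-++ (orbit k b) ⟨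
      length (orbit k b ++ rest)            ≡⟨ ↭-length zs↭ ⟨
      length zs                             ∎
      where open ≤-Reasoning

  record Circuit (a : E) : Set where
    field
      closedPath : ClosedPath a
    open ClosedPath closedPath public
    field
      ≈-closed : ∀ {x y} → x ∈∼ (a ∷ rest) → x ≈ y → y ∈∼ (a ∷ rest)

  -- Each splice lengthens the path, and distinctness bounds its length by `length edges`, so the
  -- fuel cannot run out. When no splice is possible, the path is `≈`-closed.
  saturate : ∀ {a} fuel (C : ClosedPath a) → length edges < fuel + length (ClosedPath.rest C) → Circuit a
  saturate zero C enough = ⊥-elim (<-irrefl refl
    (≤-trans enough (≤-trans (n≤1+n _) (distinct⇒length≤ (ClosedPath.distinct C)))))
  saturate {a} (suc fuel) C enough
    with any? (λ c → any? (λ b → (c ≈.≟ b) ×-dec ¬? (any? (b ∼.≟_) (a ∷ ClosedPath.rest C))) edges)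
           (a ∷ ClosedPath.rest C)
  ... | yes found with find found
  ...   | c , c∈ , found′ with find found′
  ...     | b , _ , c≈b , b∉ with extend C c∈ c≈b b∉
  ...       | C′ , longer = saturate fuel C′
    (≤-trans enough (≤-trans (≤-reflexive (sym (+-suc fuel _))) (+-monoʳ-≤ fuel longer)))
  saturate {a} (suc fuel) C enough | no none = record
    { closedPath = C
    ; ≈-closed = λ {x} {y} x∈ x≈y → let c , c∈ , x∼c = find x∈ in
        decidable-stable (any? (y ∼.≟_) (a ∷ rest)) λ y∉ →
          none (lose c∈ (lose (complete y) (≈.trans (≈.sym (∼⇒≈ x∼c)) x≈y , y∉)))
    }
    where open ClosedPath C

  abstract
    circuit : ∀ a → Circuit a
    circuit a = saturate (suc (length edges)) (orbitPath a) (s≤s (m≤m+n _ _))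

-- Harmonious permutations

nth : {A : Set} → A → List A → ℕ → A
nth a [] _ = a
nth a (x ∷ xs) zero = x
nth a (x ∷ xs) (suc j) = nth a xs j

nth∈ : {A : Set} (a : A) (xs : List A) {j : ℕ} → j < length xs → nth a xs j ∈ xs
nth∈ a (x ∷ xs) {zero} _ = here refl
nth∈ a (x ∷ xs) {suc j} (s≤s j<) = there (nth∈ a xs j<)

any⇒nth : {A : Set} {P : A → Set} (a : A) {xs : List A} → Any P xs → ∃ λ j → j < length xs × P (nth a xs j)
any⇒nth a (here p) = zero , s≤s z≤n , p
any⇒nth a (there p∈) with any⇒nth a p∈
... | j , j< , p = suc j , s≤s j< , p

nth-distinct : {A : Set} {_~_ : A → A → Set} → (∀ {x y} → x ~ y → y ~ x) → (a : A) {xs : List A} →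
  AllPairs (λ x y → ¬ x ~ y) xs → ∀ {j k} → j < length xs → k < length xs → nth a xs j ~ nth a xs k → j ≡ k
nth-distinct ~-sym a (p ∷ ps) {zero} {zero} _ _ _ = refl
nth-distinct ~-sym a (p ∷ ps) {zero} {suc k} _ (s≤s k<) r = contradiction r (All.lookup p (nth∈ a _ k<))
nth-distinct ~-sym a (p ∷ ps) {suc j} {zero} (s≤s j<) _ r = contradiction (~-sym r) (All.lookup p (nth∈ a _ j<))
nth-distinct ~-sym a (p ∷ ps) {suc j} {suc k} (s≤s j<) (s≤s k<) r = cong suc (nth-distinct ~-sym a ps j< k< r)

module Harmony {n : ℕ} (H : FinGroup n) where
  open FinGroup H public using (isGroup)

  group : Group 0ℓ 0ℓ
  group = record { isGroup = isGroup }

  open Group group public using (_∙_; ε; _⁻¹; _//_; _\\_; assoc; identityˡ; identityʳ; inverseˡ; inverseʳ)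
  open GroupProperties group public
  open ≡-Reasoning

  A : Set
  A = Fin n

  private
    variable
      v w x y z m : A

  //-cancel : ∀ x y w → (x ∙ w) // (y ∙ w) ≡ x // y
  //-cancel x y w = begin
    (x ∙ w) ∙ (y ∙ w) ⁻¹      ≡⟨ cong ((x ∙ w) ∙_) (⁻¹-anti-homo-∙ y w) ⟩
    (x ∙ w) ∙ (w ⁻¹ ∙ y ⁻¹)   ≡⟨ assoc _ _ _ ⟨
    ((x ∙ w) // w) ∙ y ⁻¹     ≡⟨ cong (_∙ y ⁻¹) (//-rightDividesʳ w x) ⟩
    x // y                    ∎

  //-trans : ∀ x y w → (x // y) ∙ (y // w) ≡ x // w
  //-trans x y w = trans (sym (assoc _ _ _)) (cong (_∙ w ⁻¹) (//-rightDividesˡ y x))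

  \\-∙ : ∀ x y w → (x ∙ y) \\ w ≡ y \\ (x \\ w)
  \\-∙ x y w = trans (cong (_∙ w) (⁻¹-anti-homo-∙ x y)) (assoc _ _ _)

  module Powers (x : A) = Circuits (allFin n) ∈-allFin (isDecEquivalence Fin._≟_) (isDecEquivalence Fin._≟_)
    id (_∙ x) (cong (_∙ x)) (λ {a} {b} → ∙-cancelʳ x a b)

  abstract
    -- With k + 1 the order of `x`, the inverse of `x` is the power x^k; so in a finite group
    -- closure under products gives closure under inverses.
    ⁻¹-closed : {P : A → Set} → P ε → (∀ {v w} → P v → P w → P (v ∙ w)) → P x → P (x ⁻¹)
    ⁻¹-closed {x = x} {P} Pε P∙ Px with Powers.firstReturn x ε
    ... | k , return , _ = subst P (inverseˡ-unique _ _ (trans (sym (Powers.iter-f x k ε)) return)) (power∈ k Pε)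
      where
      power∈ : ∀ k {b} → P b → P (Powers.iter x k b)
      power∈ zero Pb = Pb
      power∈ (suc k) Pb = power∈ k (P∙ Pb Px)

  record Subgroup : Set₁ where
    field
      Mem : A → Set
      mem? : ∀ v → Dec (Mem v)
      ε∈ : Mem ε
      ∙∈ : Mem v → Mem w → Mem (v ∙ w)
    ⁻¹∈ : Mem v → Mem (v ⁻¹)
    ⁻¹∈ = ⁻¹-closed {P = Mem} ε∈ ∙∈

  -- `cyclic` expresses that `next` is a single cycle as an induction principle along the cycle,
  -- starting from `ε`. In this form the extension step and the connectivity argument use it.
  record Harmonious (S : Subgroup) : Set₁ where
    open Subgroup S
    field
      next : A → A
      next∈ : Mem v → Mem (next v)
      next-injective : Mem v → Mem w → next v ≡ next w → v ≡ w
      label-injective : Mem v → Mem w → v \\ (next v ∙ next v) ≡ w \\ (next w ∙ next w) → v ≡ w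
      cyclic : (P : A → Set) → P ε → (∀ {v} → Mem v → P v → P (next v)) → Mem v → P v

  -- Right cosets, double cosets and transversals

  module Cosets (S : Subgroup) where
    open Subgroup S

    _∼_ : A → A → Set
    x ∼ y = Mem (x // y)

    abstract
      ∼-refl : x ∼ x
      ∼-refl {x} = subst Mem (sym (inverseʳ x)) ε∈

      ∼-sym : x ∼ y → y ∼ x
      ∼-sym {x} {y} p = subst Mem (⁻¹-anti-homo-// x y) (⁻¹∈ p)

      ∼-trans : x ∼ y → y ∼ w → x ∼ w
      ∼-trans {x} {y} {w} p q = subst Mem (//-trans x y w) (∙∈ p q)

      ∼-∙ʳ : x ∼ y → (x ∙ w) ∼ (y ∙ w)
      ∼-∙ʳ {x} {y} {w} = subst Mem (sym (//-cancel x y w))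

      ∼-∙ʳ⁻¹ : (x ∙ w) ∼ (y ∙ w) → x ∼ y
      ∼-∙ʳ⁻¹ {x} {w} {y} = subst Mem (//-cancel x y w)

      ∼-∙ˡ : Mem m → (m ∙ x) ∼ x
      ∼-∙ˡ {m} {x} = subst Mem (sym (//-rightDividesʳ x m))

      Mem⇒∼ε : Mem x → x ∼ ε
      Mem⇒∼ε {x} p = subst (_∼ ε) (identityʳ x) (∼-∙ˡ p)

    -- d 0 , … , d (size - 1) represent the right cosets of S in ⟨ S , z ⟩; d size only closes the
    -- cycle, up to a factor in S.
    record Transversal (z : A) : Set where
      field
        size-1 : ℕ
        d : ℕ → A
      size : ℕ
      size = suc size-1
      Covered : A → Set
      Covered v = ∃ λ j → j < size × v ∼ d j
      field
        d0≡ε : d 0 ≡ ε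
        d-step : ∀ {j} → j < size → Mem (z \\ (d j \\ d (suc j)))
        d-last : d size ∼ ε
        d-distinct : ∀ {j k} → j < size → k < size → d j ∼ d k → j ≡ k
        covered-∙ : Covered v → Covered w → Covered (v ∙ w)
        covered-z : Covered z

    -- The double cosets of S.  With f = (_∙ z), a circuit steps from x to the coset of some
    -- x ∙ z ∙ m, m ∈ S.
    _≈_ : A → A → Set
    x ≈ y = ∃ λ m → Mem m × y ∼ (x ∙ m)

    abstract
      ∼⇒≈ : x ∼ y → x ≈ y
      ∼⇒≈ {x} {y} p = ε , ε∈ , subst (y ∼_) (sym (identityʳ x)) (∼-sym p)

      ≈-sym : x ≈ y → y ≈ x
      ≈-sym {x} {y} (m , m∈ , p) = m ⁻¹ , ⁻¹∈ m∈ ,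
        ∼-sym (subst ((y ∙ m ⁻¹) ∼_) (//-rightDividesʳ m x) (∼-∙ʳ p))

      ≈-trans : x ≈ y → y ≈ w → x ≈ w
      ≈-trans {x} {w = w} (m , m∈ , p) (m′ , m′∈ , q) = m ∙ m′ , ∙∈ m∈ m′∈ ,
        ∼-trans q (subst (λ e → (_ ∙ m′) ∼ e) (assoc x m m′) (∼-∙ʳ p))

      ∼-isDecEquivalence : IsDecEquivalence _∼_
      ∼-isDecEquivalence = record
        { isEquivalence = record { refl = ∼-refl ; sym = ∼-sym ; trans = ∼-trans }
        ; _≟_ = λ x y → mem? (x // y)
        }

      ≈-isDecEquivalence : IsDecEquivalence _≈_
      ≈-isDecEquivalence = record
        { isEquivalence = record { refl = ∼⇒≈ ∼-refl ; sym = ≈-sym ; trans = ≈-trans }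
        ; _≟_ = λ x y → Fin.any? λ m → mem? m ×-dec mem? (y // (x ∙ m))
        }

    module Transversals (z : A) where
      open Circuits (allFin n) ∈-allFin ∼-isDecEquivalence ≈-isDecEquivalence ∼⇒≈ (_∙ z) ∼-∙ʳ ∼-∙ʳ⁻¹

      open Circuit (circuit ε)

      reps : List A
      reps = ε ∷ rest

      Mem⁺ : A → Set
      Mem⁺ v = v ∈∼ reps

      -- The circuit uses up every double coset that it meets, and `v ∙ m` lies in the double coset
      -- of `v`.
      ∙M∈⁺ : Mem⁺ v → Mem m → Mem⁺ (v ∙ m)
      ∙M∈⁺ v∈ m∈ = ≈-closed v∈ (_ , m∈ , ∼-refl)

      -- An entry `y` following `a` has the form m′ a z m with m′ and m in `S`. Right multiplication
      -- preserves `Mem⁺` for m′ and m by `∙M∈⁺`, for `a` by hypothesis, and for `z` because the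
      -- circuit is closed under `f`. So stability travels along the path.
      path∙∈⁺ : ∀ {a b} xs → Path a xs b → (∀ {v} → Mem⁺ v → Mem⁺ (v ∙ a)) →
        x ∈ xs → ∀ {v} → Mem⁺ v → Mem⁺ (v ∙ x)
      path∙∈⁺ {a = a} (y ∷ xs) ((m , m∈ , y∼) , p) stable = λ
        { (here refl) → step
        ; (there x∈) → path∙∈⁺ xs p step x∈
        }
        where
        step : ∀ {v} → Mem⁺ v → Mem⁺ (v ∙ y)
        step {v} v∈ = subst Mem⁺ eq (∙M∈⁺ (f-closed (stable (∙M∈⁺ v∈ y∼))) m∈)
          where
          eq : (((v ∙ (y // ((a ∙ z) ∙ m))) ∙ a) ∙ z) ∙ m ≡ v ∙ y
          eq = begin
            (((v ∙ (y // ((a ∙ z) ∙ m))) ∙ a) ∙ z) ∙ m ≡⟨ cong (_∙ m) (assoc _ _ _) ⟩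
            ((v ∙ (y // ((a ∙ z) ∙ m))) ∙ (a ∙ z)) ∙ m ≡⟨ assoc _ _ _ ⟩
            (v ∙ (y // ((a ∙ z) ∙ m))) ∙ ((a ∙ z) ∙ m) ≡⟨ assoc _ _ _ ⟩
            v ∙ ((y // ((a ∙ z) ∙ m)) ∙ ((a ∙ z) ∙ m)) ≡⟨ cong (v ∙_) (//-rightDividesˡ _ y) ⟩
            v ∙ y                                       ∎

      rep∙∈⁺ : x ∈ reps → Mem⁺ v → Mem⁺ (v ∙ x)
      rep∙∈⁺ (here refl) v∈ = ∙M∈⁺ v∈ ε∈
      rep∙∈⁺ (there x∈) = path∙∈⁺ rest path (λ v∈ → ∙M∈⁺ v∈ ε∈) x∈

      -- An entry following `a` is m′ a z m, with an unwanted left factor m′ in `S`. Dropping these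
      -- factors one after another, starting from `c`, keeps every right coset and puts each
      -- quotient d_j⁻¹ d_{j+1} into z S.
      Lift : List A → A → A → A → Set
      Lift xs a b c = ∃ λ (d : ℕ → A) → d 0 ≡ c
        × (∀ {j} → j < suc (length xs) → Mem (z \\ (d j \\ d (suc j))))
        × (∀ {j} → j < suc (length xs) → d j ∼ nth ε (a ∷ xs) j)
        × d (suc (length xs)) ∼ b

      lift : ∀ xs {a b c} → Path a xs b → c ∼ a → Lift xs a b c
      lift [] {a} {b} {c} (m , m∈ , b∼) c∼a = d , refl , step , close , ∼-trans (∼-∙ʳ (∼-∙ʳ c∼a)) (∼-sym b∼)
        where
        d : ℕ → A
        d zero = c
        d (suc _) = (c ∙ z) ∙ m
        step : ∀ {j} → j < 1 → Mem (z \\ (d j \\ d (suc j)))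
        step (s≤s z≤n) = subst Mem (sym (trans (sym (\\-∙ c z _)) (\\-leftDividesʳ (c ∙ z) m))) m∈
        close : ∀ {j} → j < 1 → d j ∼ nth ε (a ∷ []) j
        close (s≤s z≤n) = c∼a
      lift (x ∷ xs) {a} {b} {c} ((m , m∈ , x∼) , p) c∼a
        with lift xs {c = (c ∙ z) ∙ m} p (∼-trans (∼-∙ʳ (∼-∙ʳ c∼a)) (∼-sym x∼))
      ... | d′ , d′0≡ , step′ , close′ , last = d , refl , step , close , last
        where
        d : ℕ → A
        d zero = c
        d (suc j) = d′ j
        step : ∀ {j} → j < suc (suc (length xs)) → Mem (z \\ (d j \\ d (suc j)))
        step {zero} _ = subst Mem (sym (trans (cong (λ e → z \\ (c \\ e)) d′0≡)
          (trans (sym (\\-∙ c z _)) (\\-leftDividesʳ (c ∙ z) m)))) m∈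
        step {suc j} (s≤s j<) = step′ j<
        close : ∀ {j} → j < suc (suc (length xs)) → d j ∼ nth ε (a ∷ x ∷ xs) j
        close {zero} _ = c∼a
        close {suc j} (s≤s j<) = close′ j<

      transversal : Transversal z
      transversal with lift rest path ∼-refl
      ... | d , d0≡ε , d-step , d∼rep , d-last = record
        { size-1 = length rest
        ; d = d
        ; d0≡ε = d0≡ε
        ; d-step = d-step
        ; d-last = d-last
        ; d-distinct = λ j< k< r →
            nth-distinct ∼-sym ε distinct j< k< (∼-trans (∼-sym (d∼rep j<)) (∼-trans r (d∼rep k<)))
        ; covered-∙ = λ v∈ w∈ → covered (∙∈⁺ (reached v∈) (reached w∈))
        ; covered-z = covered (subst Mem⁺ (identityˡ z) (f-closed (here ∼-refl)))
        }
        where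
        covered : Mem⁺ v → ∃ λ j → j < length reps × v ∼ d j
        covered v∈ with any⇒nth ε v∈
        ... | j , j< , v∼ = j , j< , ∼-trans v∼ (∼-sym (d∼rep j<))
        reached : (∃ λ j → j < length reps × v ∼ d j) → Mem⁺ v
        reached (j , j< , v∼) = lose (nth∈ ε reps j<) (∼-trans v∼ (d∼rep j<))
        ∙∈⁺ : Mem⁺ v → Mem⁺ w → Mem⁺ (v ∙ w)
        ∙∈⁺ {v} {w} v∈ w∈ with find w∈
        ... | x , x∈ , w∼x = subst Mem⁺ (trans (assoc _ _ _) (cong (v ∙_) (//-rightDividesˡ x w)))
          (rep∙∈⁺ x∈ (∙M∈⁺ v∈ w∼x))

  -- Extending a harmonious permutation by one generator

  module Extend (S : Subgroup) (h : Harmonious S) (z : A) (T : Cosets.Transversal S z) where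
    open Subgroup S
    open Harmonious h
    open Cosets S
    open Transversal T

    subgroup : Subgroup
    subgroup = record
      { Mem = Covered
      ; mem? = λ v → anyUpTo? (λ j → mem? (v // d j)) size
      ; ε∈ = 0 , s≤s z≤n , subst (ε ∼_) (sym d0≡ε) ∼-refl
      ; ∙∈ = covered-∙
      }

    Mem⊆Covered : Mem v → Covered v
    Mem⊆Covered v∈ = 0 , s≤s z≤n , subst (_ ∼_) (sym d0≡ε) (Mem⇒∼ε v∈)

    jump : ℕ → A → A
    jump j m with suc j <? size
    ... | yes _ = m ∙ d (suc j)
    ... | no _ = next m

    jump-< : ∀ {j} m → suc j < size → jump j m ≡ m ∙ d (suc j)
    jump-< {j} m sj< with suc j <? size
    ... | yes _ = refl
    ... | no sj≮ = contradiction sj< sj≮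

    jump-≮ : ∀ {j} m → ¬ suc j < size → jump j m ≡ next m
    jump-≮ {j} m sj≮ with suc j <? size
    ... | yes sj< = contradiction sj< sj≮
    ... | no _ = refl

    next⁺ : A → A
    next⁺ v with Subgroup.mem? subgroup v
    ... | yes (j , _) = jump j (v // d j)
    ... | no _ = v

    next⁺-∙d : ∀ {j} → Mem m → j < size → next⁺ (m ∙ d j) ≡ jump j m
    next⁺-∙d {m} {j} m∈ j< with Subgroup.mem? subgroup (m ∙ d j)
    ... | no ∄ = contradiction (j , j< , ∼-∙ˡ m∈) ∄
    ... | yes (k , k< , r) with d-distinct j< k< (∼-trans (∼-sym (∼-∙ˡ m∈)) r)
    ...   | refl = cong (jump j) (//-rightDividesʳ (d j) m)

    data Coordinates : A → Set where
      coordinates : ∀ m j → Mem m → j < size → Coordinates (m ∙ d j)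

    coordinatesOf : Covered v → Coordinates v
    coordinatesOf {v} (j , j< , v∼) =
      subst Coordinates (//-rightDividesˡ (d j) v) (coordinates (v // d j) j v∼ j<)

    ∼-next-d0 : Mem m → next m ∼ d 0
    ∼-next-d0 m∈ = subst (next _ ∼_) (sym d0≡ε) (Mem⇒∼ε (next∈ m∈))

    last-unique : ∀ {j k} → j < size → k < size → ¬ suc j < size → ¬ suc k < size → j ≡ k
    last-unique j< k< sj≮ sk≮ = suc-injective (trans (≤-antisym j< (≮⇒≥ sj≮)) (≤-antisym (≮⇒≥ sk≮) k<))

    -- The right coset of the image determines `j`: it is that of d_{j+1} before the last index, and
    -- `S` itself at the last. Then `m` is recovered by cancellation or by injectivity of `next`.
    jump-injective : ∀ {j k m′} → Mem m → Mem m′ → j < size → k < size →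
      jump j m ≡ jump k m′ → j ≡ k × m ≡ m′
    jump-injective {m} {j} {k} {m′} m∈ m′∈ j< k< eq = cases (suc j <? size) (suc k <? size)
      where
      same : ∀ {a b} → jump j m ∼ a → jump k m′ ∼ b → a ∼ b
      same p q = ∼-trans (∼-sym p) (subst (_∼ _) (sym eq) q)
      inner : ∀ {j m} → Mem m → suc j < size → jump j m ∼ d (suc j)
      inner {m = m} m∈ sj< = subst (_∼ _) (sym (jump-< m sj<)) (∼-∙ˡ m∈)
      outer : ∀ {j m} → Mem m → ¬ suc j < size → jump j m ∼ d 0
      outer {m = m} m∈ sj≮ = subst (_∼ _) (sym (jump-≮ m sj≮)) (∼-next-d0 m∈)
      cases : Dec (suc j < size) → Dec (suc k < size) → j ≡ k × m ≡ m′
      cases (yes sj<) (yes sk<)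
        with refl ← d-distinct sj< sk< (same (inner m∈ sj<) (inner m′∈ sk<)) =
        refl , ∙-cancelʳ _ _ _ (trans (sym (jump-< m sj<)) (trans eq (jump-< m′ sk<)))
      cases (yes sj<) (no sk≮)
        with () ← d-distinct sj< (s≤s z≤n) (same (inner m∈ sj<) (outer m′∈ sk≮))
      cases (no sj≮) (yes sk<)
        with () ← d-distinct (s≤s z≤n) sk< (same (outer m∈ sj≮) (inner m′∈ sk<))
      cases (no sj≮) (no sk≮)
        with refl ← last-unique j< k< sj≮ sk≮ =
        refl , next-injective m∈ m′∈ (trans (sym (jump-≮ m sj≮)) (trans eq (jump-≮ m′ sk≮)))

    label : ℕ → A → A
    label j m = (m ∙ d j) \\ (jump j m ∙ jump j m)

    label-< : ∀ {j} m → suc j < size → label j m ≡ (d j \\ d (suc j)) ∙ (m ∙ d (suc j))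
    label-< {j} m sj< = begin
      label j m                                              ≡⟨ cong (λ e → (m ∙ d j) \\ (e ∙ e)) (jump-< m sj<) ⟩
      (m ∙ d j) \\ ((m ∙ d′) ∙ (m ∙ d′))                     ≡⟨ \\-∙ m (d j) _ ⟩
      d j \\ (m \\ ((m ∙ d′) ∙ (m ∙ d′)))                    ≡⟨ cong (λ e → d j \\ (m \\ e)) (assoc m d′ _) ⟩
      d j \\ (m \\ (m ∙ (d′ ∙ (m ∙ d′))))                    ≡⟨ cong (d j \\_) (\\-leftDividesʳ m _) ⟩
      d j \\ (d′ ∙ (m ∙ d′))                                 ≡⟨ assoc _ _ _ ⟨
      (d j \\ d′) ∙ (m ∙ d′)                                 ∎
      where
      d′ = d (suc j)

    label-≮ : ∀ {j} m → ¬ suc j < size → label j m ≡ d j \\ (m \\ (next m ∙ next m))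
    label-≮ {j} m sj≮ = trans (cong (λ e → (m ∙ d j) \\ (e ∙ e)) (jump-≮ m sj≮)) (\\-∙ m (d j) _)

    -- The label is d_j⁻¹ d_{j+1} m d_{j+1}, and d_j⁻¹ d_{j+1} lies in z S by `d-step`. Removing `z`
    -- leaves an element of the coset of d_{j+1}.
    label-coset-< : ∀ {j} → Mem m → j < size → suc j < size → (z \\ label j m) ∼ d (suc j)
    label-coset-< {m} {j} m∈ j< sj< = subst (_∼ d (suc j)) eq (∼-∙ˡ (∙∈ (d-step j<) m∈))
      where
      d′ = d (suc j)
      eq : ((z \\ (d j \\ d′)) ∙ m) ∙ d′ ≡ z \\ label j m
      eq = begin
        ((z \\ (d j \\ d′)) ∙ m) ∙ d′   ≡⟨ assoc _ _ _ ⟩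
        (z \\ (d j \\ d′)) ∙ (m ∙ d′)   ≡⟨ assoc _ _ _ ⟩
        z \\ ((d j \\ d′) ∙ (m ∙ d′))   ≡⟨ cong (z \\_) (label-< m sj<) ⟨
        z \\ label j m                   ∎

    -- At the last index d_{j+1} lies in `S` by `d-last`, so `d-step` puts d_j⁻¹ itself into z S;
    -- the other factor m⁻¹ ν(m)² of the label is in `S`.
    label-coset-≮ : ∀ {j} → Mem m → j < size → ¬ suc j < size → (z \\ label j m) ∼ d 0
    label-coset-≮ {m} {j} m∈ j< sj≮ = subst ((z \\ label j m) ∼_) (sym d0≡ε) (Mem⇒∼ε (subst Mem eq
      (∙∈ (d-step j<) (∙∈ (⁻¹∈ d∈) (∙∈ (⁻¹∈ m∈) (∙∈ (next∈ m∈) (next∈ m∈)))))))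
      where
      X = m \\ (next m ∙ next m)
      d∈ : Mem (d (suc j))
      d∈ = subst Mem (trans (cong (d (suc j) ∙_) ε⁻¹≈ε) (identityʳ _))
        (subst (λ k → d k ∼ ε) (≤-antisym (≮⇒≥ sj≮) j<) d-last)
      eq : (z \\ (d j \\ d (suc j))) ∙ (d (suc j) \\ X) ≡ z \\ label j m
      eq = begin
        (z \\ (d j \\ d (suc j))) ∙ (d (suc j) \\ X)   ≡⟨ assoc _ _ _ ⟩
        z \\ ((d j \\ d (suc j)) ∙ (d (suc j) \\ X))   ≡⟨ cong (z \\_) (assoc _ _ _) ⟩
        z \\ (d j \\ (d (suc j) ∙ (d (suc j) \\ X)))   ≡⟨ cong (λ e → z \\ (d j \\ e)) (\\-leftDividesˡ _ X) ⟩
        z \\ (d j \\ X)                                ≡⟨ cong (z \\_) (label-≮ m sj≮) ⟨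
        z \\ label j m                                 ∎

    -- As for `jump`, the indices are separated by cosets, here those of the labels after removal of
    -- `z`.
    label-injective⁺ : ∀ {j k m′} → Mem m → Mem m′ → j < size → k < size →
      label j m ≡ label k m′ → j ≡ k × m ≡ m′
    label-injective⁺ {m} {j} {k} {m′} m∈ m′∈ j< k< eq = cases (suc j <? size) (suc k <? size)
      where
      same : ∀ {a b} → (z \\ label j m) ∼ a → (z \\ label k m′) ∼ b → a ∼ b
      same p q = ∼-trans (∼-sym p) (subst (λ l → (z \\ l) ∼ _) (sym eq) q)
      cases : Dec (suc j < size) → Dec (suc k < size) → j ≡ k × m ≡ m′
      cases (yes sj<) (yes sk<)
        with refl ← d-distinct sj< sk< (same (label-coset-< m∈ j< sj<) (label-coset-< m′∈ k< sk<)) =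
        refl , ∙-cancelʳ _ _ _ (∙-cancelˡ _ _ _ (trans (sym (label-< m sj<)) (trans eq (label-< m′ sk<))))
      cases (yes sj<) (no sk≮)
        with () ← d-distinct sj< (s≤s z≤n) (same (label-coset-< m∈ j< sj<) (label-coset-≮ m′∈ k< sk≮))
      cases (no sj≮) (yes sk<)
        with () ← d-distinct (s≤s z≤n) sk< (same (label-coset-≮ m∈ j< sj≮) (label-coset-< m′∈ k< sk<))
      cases (no sj≮) (no sk≮)
        with refl ← last-unique j< k< sj≮ sk≮ =
        refl , label-injective m∈ m′∈
          (∙-cancelˡ _ _ _ (trans (sym (label-≮ m sj≮)) (trans eq (label-≮ m′ sk≮))))

    jump∈ : ∀ {j} → Mem m → j < size → Covered (jump j m)
    jump∈ {m} {j} m∈ j< with suc j <? size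
    ... | yes sj< = suc j , sj< , ∼-∙ˡ m∈
    ... | no _ = Mem⊆Covered (next∈ m∈)

    harmonious : Harmonious subgroup
    harmonious = record
      { next = next⁺
      ; next∈ = λ v∈ → next∈⁺ (coordinatesOf v∈)
      ; next-injective = λ v∈ w∈ → next-injective⁺ (coordinatesOf v∈) (coordinatesOf w∈)
      ; label-injective = λ v∈ w∈ → label-injective′ (coordinatesOf v∈) (coordinatesOf w∈)
      ; cyclic = λ P Pε closed v∈ → cyclic⁺ P Pε closed (coordinatesOf v∈)
      }
      where
      next∈⁺ : Coordinates v → Covered (next⁺ v)
      next∈⁺ (coordinates m j m∈ j<) = subst Covered (sym (next⁺-∙d m∈ j<)) (jump∈ m∈ j<)

      next-injective⁺ : Coordinates v → Coordinates w → next⁺ v ≡ next⁺ w → v ≡ w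
      next-injective⁺ (coordinates m j m∈ j<) (coordinates m′ k m′∈ k<) eq
        with refl , refl ← jump-injective m∈ m′∈ j< k<
          (trans (sym (next⁺-∙d m∈ j<)) (trans eq (next⁺-∙d m′∈ k<))) = refl

      labelOf : ∀ {j} → Mem m → j < size →
        (m ∙ d j) \\ (next⁺ (m ∙ d j) ∙ next⁺ (m ∙ d j)) ≡ label j m
      labelOf m∈ j< = cong (λ e → _ \\ (e ∙ e)) (next⁺-∙d m∈ j<)

      label-injective′ : Coordinates v → Coordinates w →
        v \\ (next⁺ v ∙ next⁺ v) ≡ w \\ (next⁺ w ∙ next⁺ w) → v ≡ w
      label-injective′ (coordinates m j m∈ j<) (coordinates m′ k m′∈ k<) eq
        with refl , refl ← label-injective⁺ m∈ m′∈ j< k<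
          (trans (sym (labelOf m∈ j<)) (trans eq (labelOf m′∈ k<))) = refl

      module _ (P : A → Set) (Pε : P ε) (closed : ∀ {v} → Covered v → P v → P (next⁺ v)) where
        jumpP : ∀ {m j} → Mem m → j < size → P (m ∙ d j) → P (jump j m)
        jumpP m∈ j< p = subst P (next⁺-∙d m∈ j<) (closed (_ , j< , ∼-∙ˡ m∈) p)

        -- The new permutation runs from m = m d_0 through m d_1 , m d_2 , ... and, after the last
        -- index, on to `next m`. So the old cycle is followed with a whole row inserted after each
        -- member.
        row : Mem m → P m → ∀ j → j < size → P (m ∙ d j)
        row {m} m∈ p zero _ = subst P (trans (sym (identityʳ m)) (cong (m ∙_) (sym d0≡ε))) p
        row {m} m∈ p (suc j) sj< =
          subst P (jump-< m sj<) (jumpP m∈ (<⇒≤ sj<) (row m∈ p j (<⇒≤ sj<)))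

        nextP : Mem m → P m → P (next m)
        nextP {m} m∈ p = subst P (jump-≮ {size-1} m (<-irrefl refl)) (jumpP m∈ ≤-refl (row m∈ p size-1 ≤-refl))

        cyclic⁺ : Coordinates v → P v
        cyclic⁺ (coordinates m j m∈ j<) = row m∈ (cyclic P Pε nextP m∈) j j<

  trivial : Subgroup
  trivial = record
    { Mem = _≡ ε
    ; mem? = Fin._≟ ε
    ; ε∈ = refl
    ; ∙∈ = λ { refl refl → identityˡ ε }
    }

  trivial-harmonious : Harmonious trivial
  trivial-harmonious = record
    { next = id
    ; next∈ = id
    ; next-injective = λ { refl refl _ → refl }
    ; label-injective = λ { refl refl _ → refl }
    ; cyclic = λ { P Pε _ refl → Pε }
    }

  harmonious-containing : ∀ zs → Σ Subgroup λ S → Harmonious S × All (Subgroup.Mem S) zs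
  harmonious-containing [] = trivial , trivial-harmonious , []
  harmonious-containing (z ∷ zs) with harmonious-containing zs
  ... | S , h , zs∈ = subgroup , harmonious , Transversal.covered-z T ∷ All.map Mem⊆Covered zs∈
    where
    open Cosets S using (module Transversal; module Transversals)
    T = Transversals.transversal z
    open Extend S h z T

  record HarmoniousCycle : Set₁ where
    field
      next : A → A
      next-injective : next v ≡ next w → v ≡ w
      label-injective : v \\ (next v ∙ next v) ≡ w \\ (next w ∙ next w) → v ≡ w
      cyclic : (P : A → Set) → P ε → (∀ {v} → P v → P (next v)) → ∀ v → P v

  harmoniousCycle : HarmoniousCycle
  harmoniousCycle with harmonious-containing (allFin n)
  ... | S , h , all∈ = record
    { next = next
    ; next-injective = next-injective (mem _) (mem _)
    ; label-injective = label-injective (mem _) (mem _)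
    ; cyclic = λ P Pε closed v → cyclic P Pε (λ _ → closed) (mem v)
    }
    where
    open Harmonious h
    mem : ∀ v → Subgroup.Mem S v
    mem v = All.lookup all∈ (∈-allFin v)

-- Squaring in groups of odd order

unique-resp-↭ : {B : Set} {xs ys : List B} → xs ↭ ys → Unique xs → Unique ys
unique-resp-↭ {B} xs↭ys = ↭ₛ.Unique-resp-↭ (setoid B) (↭⇒↭ₛ xs↭ys)

∈⇒↭ : {B : Set} {x : B} {xs : List B} → x ∈ xs → ∃ λ ys → xs ↭ x ∷ ys
∈⇒↭ x∈xs with ∈-∃++ x∈xs
... | as , bs , refl = as ++ bs , shift _ as bs

odd≢even : ∀ k l → suc (k + k) ≢ l + l
odd≢even zero (suc l) eq with () ← trans (suc-injective eq) (+-suc l l)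
odd≢even (suc k) (suc l) eq = odd≢even k l (suc-injective
  (trans (cong suc (sym (+-suc k k))) (trans (suc-injective eq) (+-suc l l))))

parity : ∀ m → (∃ λ k → m ≡ k + k) ⊎ (∃ λ k → m ≡ suc (k + k))
parity zero = inj₁ (0 , refl)
parity (suc m) with parity m
... | inj₁ (k , refl) = inj₂ (k , refl)
... | inj₂ (k , refl) = inj₁ (suc k , cong suc (sym (+-suc k k)))

-- Elements leave the list in pairs `x` , `τ x`. What remains is known only up to permutation, hence
-- the recursion on `fuel`.
involution⇒even : {B : Set} (τ : B → B) → (∀ x → τ (τ x) ≡ x) → (∀ x → τ x ≢ x) →
  ∀ fuel (xs : List B) → length xs ≤ fuel → Unique xs → (∀ {x} → x ∈ xs → τ x ∈ xs) →
  ∃ λ k → length xs ≡ k + k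
involution⇒even τ inv fpf fuel [] _ _ _ = 0 , refl
involution⇒even τ inv fpf (suc fuel) (x ∷ xs) (s≤s len) xs! closed with closed (here refl)
... | here τx≡x = contradiction τx≡x (fpf x)
... | there τx∈xs with ∈⇒↭ τx∈xs
...   | ys , xs↭ with unique-resp-↭ (prep x xs↭) xs!
...     | (_ ∷ x∉ys) ∷ τx∉ys ∷ ys! with involution⇒even τ inv fpf fuel ys
          (≤-trans (n≤1+n _) (≤-trans (≤-reflexive (sym (↭-length xs↭))) len)) ys! closed′
  where
  closed′ : ∀ {y} → y ∈ ys → τ y ∈ ys
  closed′ {y} y∈ with Any-resp-↭ (prep x xs↭) (closed (Any-resp-↭ (↭-sym (prep x xs↭)) (there (there y∈))))
  ... | here τy≡x = contradiction (trans (cong τ (sym τy≡x)) (inv y)) (All.lookup τx∉ys y∈)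
  ... | there (here τy≡τx) =
    contradiction (trans (sym (inv x)) (trans (cong τ (sym τy≡τx)) (inv y))) (All.lookup x∉ys y∈)
  ... | there (there τy∈) = τy∈
...       | k , eq = suc k ,
  trans (cong suc (↭-length xs↭)) (trans (cong (suc ∘ suc) eq) (cong suc (sym (+-suc k k))))

module Squares {n : ℕ} (H : FinGroup n) (odd : Odd n) where
  open Harmony H
  open ≡-Reasoning

  -- Otherwise left multiplication by `t` would be a fixed-point-free involution on an odd number of
  -- elements.
  no-involution : ∀ t → t ∙ t ≡ ε → t ≡ ε
  no-involution t t² with t Fin.≟ ε
  ... | yes t≡ε = t≡ε
  ... | no t≢ε with involution⇒even (t ∙_)
        (λ x → trans (sym (assoc t t x)) (trans (cong (_∙ x) t²) (identityˡ x)))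
        (λ x tx≡x → t≢ε (identityˡ-unique t x tx≡x))
        n (allFin n) (≤-reflexive (length-tabulate id)) (Unique.allFin⁺ n) (λ _ → ∈-allFin _)
  ...   | l , len≡ = contradiction
    (trans (sym (proj₂ odd)) (trans (sym (length-tabulate id)) len≡)) (odd≢even (proj₁ odd) l)

  module _ (x : A) where
    open Powers x using (iter; iter-+; firstReturn)

    power : ℕ → A
    power k = iter k ε

    iter≡∙power : ∀ k b → iter k b ≡ b ∙ power k
    iter≡∙power zero b = sym (identityʳ b)
    iter≡∙power (suc k) b = begin
      iter k (b ∙ x)           ≡⟨ iter≡∙power k (b ∙ x) ⟩
      (b ∙ x) ∙ power k        ≡⟨ assoc b x _ ⟩
      b ∙ (x ∙ power k)        ≡⟨ cong (λ y → b ∙ (y ∙ power k)) (identityˡ x) ⟨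
      b ∙ ((ε ∙ x) ∙ power k)  ≡⟨ cong (b ∙_) (iter≡∙power k (ε ∙ x)) ⟨
      b ∙ power (suc k)        ∎

    power-+ : ∀ j k → power (j + k) ≡ power j ∙ power k
    power-+ j k = trans (sym (iter-+ j k ε)) (iter≡∙power k (power j))

    abstract
      -- If the order of `x` were 2(i + 1), then x^(i+1) would square to `ε` and so be `ε`, against
      -- minimality. So the order is 2j + 1, and x^(j+1) squares to x^(2j+2) = x.
      root : ∃ λ y → y ∙ y ≡ x
      root with firstReturn ε
      ... | k , return , minimal with parity (suc k)
      ...   | inj₁ (suc i , eq) = contradiction
                (no-involution (power (suc i))
                  (trans (sym (power-+ (suc i) (suc i))) (trans (cong power (sym eq)) return)))
                (minimal (subst (i <_) (sym (suc-injective eq)) (m≤n+m (suc i) i)))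
      ...   | inj₂ (j , eq) = power (suc j) , (begin
                power (suc j) ∙ power (suc j)  ≡⟨ power-+ (suc j) (suc j) ⟨
                power (suc (j + suc j))        ≡⟨ cong (power ∘ suc) (trans (+-suc j j) (sym eq)) ⟩
                power (1 + suc k)              ≡⟨ power-+ 1 (suc k) ⟩
                (ε ∙ x) ∙ power (suc k)        ≡⟨ cong ((ε ∙ x) ∙_) return ⟩
                (ε ∙ x) ∙ ε                    ≡⟨ identityʳ _ ⟩
                ε ∙ x                          ≡⟨ identityˡ x ⟩
                x                              ∎)

  -- Squaring recovers an element from its root, so taking roots is injective, hence onto by
  -- finiteness.
  isRoot : ∀ y → ∃ λ x → y ≡ proj₁ (root x)
  isRoot y with ∈-map⁻ _ (unique⊆⇒⊇ Fin._≟_ roots! (λ {x} _ → ∈-allFin x)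
                            (≤-reflexive (sym (length-map _ (allFin n)))) (∈-allFin y))
    where
    roots! : Unique (map (proj₁ ∘ root) (allFin n))
    roots! = Unique.map⁺
      (λ {x} {y} eq → trans (sym (proj₂ (root x))) (trans (cong (λ z → z ∙ z) eq) (proj₂ (root y))))
      (Unique.allFin⁺ n)
  ... | x , _ , y≡ = x , y≡

  square-injective : ∀ {x y} → x ∙ x ≡ y ∙ y → x ≡ y
  square-injective {x} {y} eq with isRoot x | isRoot y
  ... | a , refl | b , refl = cong (proj₁ ∘ root) (trans (sym (proj₂ (root a))) (trans eq (proj₂ (root b))))

-- The digraph on ℤ₂ × H

module Occurrences {C : Set} (_≟_ : DecidableEquality C) where

  occ-≡ : ∀ x ys → occ _≟_ x (x ∷ ys) ≡ suc (occ _≟_ x ys)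
  occ-≡ x ys with x ≟ x
  ... | yes _ = refl
  ... | no x≢x = contradiction refl x≢x

  occ-∉ : ∀ {x} ys → x ∉ ys → occ _≟_ x ys ≡ 0
  occ-∉ [] _ = refl
  occ-∉ {x} (y ∷ ys) x∉ with x ≟ y
  ... | yes x≡y = contradiction (here x≡y) x∉
  ... | no _ = occ-∉ ys (x∉ ∘ there)

  occ-∷ : ∀ x y ys → occ _≟_ x (y ∷ ys) ≡ occ _≟_ x (y ∷ []) + occ _≟_ x ys
  occ-∷ x y ys with x ≟ y
  ... | yes _ = refl
  ... | no _ = refl

  occ-↭ : ∀ x {ys zs} → ys ↭ zs → occ _≟_ x ys ≡ occ _≟_ x zs
  occ-↭ x ↭.refl = refl
  occ-↭ x {y ∷ ys} {y ∷ zs} (prep y p) = begin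
    occ _≟_ x (y ∷ ys)                      ≡⟨ occ-∷ x y ys ⟩
    occ _≟_ x (y ∷ []) + occ _≟_ x ys       ≡⟨ cong (occ _≟_ x (y ∷ []) +_) (occ-↭ x p) ⟩
    occ _≟_ x (y ∷ []) + occ _≟_ x zs       ≡⟨ occ-∷ x y zs ⟨
    occ _≟_ x (y ∷ zs)                      ∎
    where open ≡-Reasoning
  occ-↭ x {y ∷ z ∷ ys} {z ∷ y ∷ zs} (swap y z p) = begin
    occ _≟_ x (y ∷ z ∷ ys)                  ≡⟨ trans (occ-∷ x y _) (cong (#y +_) (occ-∷ x z ys)) ⟩
    #y + (#z + occ _≟_ x ys)                ≡⟨ cong (λ k → #y + (#z + k)) (occ-↭ x p) ⟩
    #y + (#z + occ _≟_ x zs)                ≡⟨ +-assoc #y #z _ ⟨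
    #y + #z + occ _≟_ x zs                  ≡⟨ cong (_+ occ _≟_ x zs) (+-comm #y #z) ⟩
    #z + #y + occ _≟_ x zs                  ≡⟨ +-assoc #z #y _ ⟩
    #z + (#y + occ _≟_ x zs)                ≡⟨ trans (occ-∷ x z _) (cong (#z +_) (occ-∷ x y zs)) ⟨
    occ _≟_ x (z ∷ y ∷ zs)                  ∎
    where
    open ≡-Reasoning
    #y = occ _≟_ x (y ∷ [])
    #z = occ _≟_ x (z ∷ [])
  occ-↭ x (↭.trans p q) = trans (occ-↭ x p) (occ-↭ x q)

  -- The pairs over `x` are just two, and uniqueness lets each of them occur only once.
  occ-doubled : ∀ {x} (es : List (C × Bool)) → Unique es → (∀ b → (x , b) ∈ es) → occ _≟_ x (map proj₁ es) ≡ 2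
  occ-doubled {x} es es! x∈ with ∈⇒↭ (x∈ true)
  ... | fs , es↭ with Any-resp-↭ es↭ (x∈ false)
  ...   | there x,f∈ with ∈⇒↭ x,f∈
  ...     | gs , fs↭ with unique-resp-↭ (↭-trans es↭ (prep _ fs↭)) es!
  ...       | (_ ∷ t∉) ∷ f∉ ∷ _ = begin
    occ _≟_ x (map proj₁ es)                ≡⟨ occ-↭ x (map⁺ proj₁ (↭-trans es↭ (prep _ fs↭))) ⟩
    occ _≟_ x (x ∷ x ∷ map proj₁ gs)        ≡⟨ occ-≡ x _ ⟩
    suc (occ _≟_ x (x ∷ map proj₁ gs))      ≡⟨ cong suc (occ-≡ x _) ⟩
    suc (suc (occ _≟_ x (map proj₁ gs)))    ≡⟨ cong (λ k → suc (suc k)) (occ-∉ _ x∉) ⟩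
    2                                       ∎
    where
    open ≡-Reasoning
    x∉ : x ∉ map proj₁ gs
    x∉ x∈gs with ∈-map⁻ proj₁ x∈gs
    ... | (_ , true) , e∈ , refl = All.lookup t∉ e∈ refl
    ... | (_ , false) , e∈ , refl = All.lookup f∉ e∈ refl

module Graph {n : ℕ} (H : FinGroup n) (cycle : Harmony.HarmoniousCycle H)
  (square-injective : ∀ {x y} → FinGroup._∙_ H x x ≡ FinGroup._∙_ H y y → x ≡ y)
  (next-ε≢ε : Harmony.HarmoniousCycle.next cycle (FinGroup.ε H) ≢ FinGroup.ε H) where
  open Harmony H
  open HarmoniousCycle cycle
  open Z2× H using (Carrier; _≟G_) renaming (_∙_ to _∙G_; ε to εG; _⁻¹ to _⁻¹G)

  pattern F = false
  pattern T = true

  -- ((a , s) , b) is the edge from (a , s) to the copy b of H, before the exchange below.  In the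
  -- values of f and ℓ the last component tells apart the two edges with the same target or label,
  -- so that their injectivity says that every element is used exactly twice.
  Edge : Set
  Edge = Carrier × Bool

  p : A
  p = next ε

  -- The four edges (site a b) take over each other's targets.  Their labels are then permuted in
  -- the opposite direction.
  pivot : Bool → Bool → A
  pivot F F = p
  pivot T F = ε
  pivot F T = ε
  pivot T T = p

  site site⁺ site⁻ : Bool → Bool → Edge
  site a b = (a , pivot a b) , b
  site⁺ F F = site T T
  site⁺ T T = site F T
  site⁺ F T = site T F
  site⁺ T F = site F F
  site⁻ F F = site T F
  site⁻ T F = site F T
  site⁻ F T = site T T
  site⁻ T T = site F F

  exchange exchange⁻¹ : Edge → Edge
  exchange ((a , s) , b) = if does (s Fin.≟ pivot a b) then site⁺ a b else ((a , s) , b)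
  exchange⁻¹ ((a , s) , b) = if does (s Fin.≟ pivot a b) then site⁻ a b else ((a , s) , b)

  exchange-site : ∀ a b → exchange (site a b) ≡ site⁺ a b
  exchange-site a b rewrite dec-true (pivot a b Fin.≟ pivot a b) refl = refl

  exchange⁻¹-site : ∀ a b → exchange⁻¹ (site a b) ≡ site⁻ a b
  exchange⁻¹-site a b rewrite dec-true (pivot a b Fin.≟ pivot a b) refl = refl

  exchange-≢ : ∀ {a s b} → s ≢ pivot a b → exchange ((a , s) , b) ≡ ((a , s) , b)
  exchange-≢ {a} {s} {b} s≢ rewrite dec-false (s Fin.≟ pivot a b) s≢ = refl

  exchange⁻¹-≢ : ∀ {a s b} → s ≢ pivot a b → exchange⁻¹ ((a , s) , b) ≡ ((a , s) , b)
  exchange⁻¹-≢ {a} {s} {b} s≢ rewrite dec-false (s Fin.≟ pivot a b) s≢ = refl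

  data View : Edge → Set where
    at-site : ∀ a b → View (site a b)
    elsewhere : ∀ a s b → s ≢ pivot a b → View ((a , s) , b)

  view : ∀ e → View e
  view ((a , s) , b) with s Fin.≟ pivot a b
  ... | yes refl = at-site a b
  ... | no s≢ = elsewhere a s b s≢

  exchange⁻¹-exchange : ∀ e → exchange⁻¹ (exchange e) ≡ e
  exchange⁻¹-exchange e with view e
  ... | elsewhere a s b s≢ = trans (cong exchange⁻¹ (exchange-≢ s≢)) (exchange⁻¹-≢ s≢)
  ... | at-site F F = trans (cong exchange⁻¹ (exchange-site F F)) (exchange⁻¹-site T T)
  ... | at-site T F = trans (cong exchange⁻¹ (exchange-site T F)) (exchange⁻¹-site F F)
  ... | at-site F T = trans (cong exchange⁻¹ (exchange-site F T)) (exchange⁻¹-site T F)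
  ... | at-site T T = trans (cong exchange⁻¹ (exchange-site T T)) (exchange⁻¹-site F T)

  exchange-exchange⁻¹ : ∀ e → exchange (exchange⁻¹ e) ≡ e
  exchange-exchange⁻¹ e with view e
  ... | elsewhere a s b s≢ = trans (cong exchange (exchange⁻¹-≢ s≢)) (exchange-≢ s≢)
  ... | at-site F F = trans (cong exchange (exchange⁻¹-site F F)) (exchange-site T F)
  ... | at-site T F = trans (cong exchange (exchange⁻¹-site T F)) (exchange-site F T)
  ... | at-site F T = trans (cong exchange (exchange⁻¹-site F T)) (exchange-site T T)
  ... | at-site T T = trans (cong exchange (exchange⁻¹-site T T)) (exchange-site F F)

  -- The factor p⁻¹ makes the edge inside copy `T` with label `ε` start at `p`, which is the pivot
  -- there; the exchange then hands its label to the new loop at the identity.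
  target₀ : Bool → Bool → A → A
  target₀ F T s = next s ∙ next s
  target₀ T T s = (s // p) ∙ s
  target₀ _ F s = s ∙ s

  label₀ : Bool → Bool → A → A
  label₀ F T s = s \\ (next s ∙ next s)
  label₀ T T s = p \\ s
  label₀ _ F s = s

  f₀ ℓ₀ f ℓ : Edge → Edge
  f₀ ((a , s) , b) = (b , target₀ a b s) , a
  ℓ₀ ((a , s) , b) = (a xor b , label₀ a b s) , a
  f = f₀ ∘ exchange
  ℓ = ℓ₀ ∘ exchange⁻¹

  target₀-injective : ∀ a b {s t} → target₀ a b s ≡ target₀ a b t → s ≡ t
  target₀-injective F T eq = next-injective (square-injective eq)
  -- Multiplied by p⁻¹ on the right, s p⁻¹ s becomes the square of s p⁻¹.
  target₀-injective T T {s} {t} eq = ∙-cancelʳ _ _ _ (square-injective (trans (sym (assoc _ _ _))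
    (trans (cong (_∙ p ⁻¹) eq) (assoc _ _ _))))
  target₀-injective F F eq = square-injective eq
  target₀-injective T F eq = square-injective eq

  label₀-injective : ∀ a b {s t} → label₀ a b s ≡ label₀ a b t → s ≡ t
  label₀-injective F T eq = label-injective eq
  label₀-injective T T eq = ∙-cancelˡ _ _ _ eq
  label₀-injective F F eq = eq
  label₀-injective T F eq = eq

  label₀≡ : ∀ a b s → s \\ target₀ a b s ≡ label₀ a b s
  label₀≡ F T s = refl
  label₀≡ T T s = trans (cong (s \\_) (assoc _ _ _)) (\\-leftDividesʳ s _)
  label₀≡ F F s = \\-leftDividesʳ s s
  label₀≡ T F s = \\-leftDividesʳ s s

  components : ∀ {a b : Bool} {s t : A} {c d : Bool} →
    _≡_ {A = Edge} ((a , s) , c) ((b , t) , d) → a ≡ b × s ≡ t × c ≡ d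
  components refl = refl , refl , refl

  f₀-injective : ∀ {e e′} → f₀ e ≡ f₀ e′ → e ≡ e′
  f₀-injective {(a , s) , b} {(_ , t) , _} eq with components eq
  ... | refl , eq′ , refl = cong (λ s → (a , s) , b) (target₀-injective a b eq′)

  ℓ₀-injective : ∀ {e e′} → ℓ₀ e ≡ ℓ₀ e′ → e ≡ e′
  ℓ₀-injective {(a , s) , b} {(_ , t) , c} eq with components eq
  ... | a+b≡a+c , eq′ , refl with xor-cancel a a+b≡a+c
    where
    xor-cancel : ∀ a {b c} → a xor b ≡ a xor c → b ≡ c
    xor-cancel F eq = eq
    xor-cancel T {F} {F} eq = refl
    xor-cancel T {T} {T} eq = refl
  ...   | refl = cong (λ s → (a , s) , b) (label₀-injective a b eq′)

  f-injective : ∀ {e e′} → f e ≡ f e′ → e ≡ e′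
  f-injective {e} {e′} eq = trans (sym (exchange⁻¹-exchange e))
    (trans (cong exchange⁻¹ (f₀-injective eq)) (exchange⁻¹-exchange e′))

  ℓ-injective : ∀ {e e′} → ℓ e ≡ ℓ e′ → e ≡ e′
  ℓ-injective {e} {e′} eq = trans (sym (exchange-exchange⁻¹ e))
    (trans (cong exchange (ℓ₀-injective eq)) (exchange-exchange⁻¹ e′))

  f-site : ∀ a b → f (site a b) ≡ f₀ (site⁺ a b)
  f-site a b = cong f₀ (exchange-site a b)

  f-≢ : ∀ {a s b} → s ≢ pivot a b → f ((a , s) , b) ≡ f₀ ((a , s) , b)
  f-≢ s≢ = cong f₀ (exchange-≢ s≢)

  ℓ-site : ∀ a b → ℓ (site a b) ≡ ℓ₀ (site⁻ a b)
  ℓ-site a b = cong ℓ₀ (exchange⁻¹-site a b)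

  quotient : Edge → Carrier
  quotient e = (proj₁ e ⁻¹G) ∙G proj₁ (f e)

  quotient≡label : ∀ e → quotient e ≡ proj₁ (ℓ e)
  quotient≡label e with view e
  ... | elsewhere a s b s≢ = begin
    quotient ((a , s) , b)                       ≡⟨ cong (λ e → ((a , s) ⁻¹G) ∙G proj₁ e) (f-≢ s≢) ⟩
    (a xor b , s \\ target₀ a b s)               ≡⟨ cong (a xor b ,_) (label₀≡ a b s) ⟩
    proj₁ (ℓ₀ ((a , s) , b))                     ≡⟨ cong (proj₁ ∘ ℓ₀) (exchange⁻¹-≢ s≢) ⟨
    proj₁ (ℓ ((a , s) , b))                      ∎
    where open ≡-Reasoning
  ... | at-site a b = begin
    quotient (site a b)                          ≡⟨ cong (λ e → ((a , pivot a b) ⁻¹G) ∙G proj₁ e) (f-site a b) ⟩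
    ((a , pivot a b) ⁻¹G) ∙G proj₁ (f₀ (site⁺ a b))  ≡⟨ at a b ⟩
    proj₁ (ℓ₀ (site⁻ a b))                       ≡⟨ cong proj₁ (ℓ-site a b) ⟨
    proj₁ (ℓ (site a b))                         ∎
    where
    open ≡-Reasoning
    -- The exchanged edges are (F , p) → (T , p), (T , ε) → (F , p²), (F , ε) → (F , ε) and (T , p)
    -- → (T , p²). Their labels (T , ε), (T , p²), (F , ε) and (F , p) are the four former labels.
    at : ∀ a b → ((a , pivot a b) ⁻¹G) ∙G proj₁ (f₀ (site⁺ a b)) ≡ proj₁ (ℓ₀ (site⁻ a b))
    at F F = cong (T ,_) (trans (label₀≡ T T p) (inverseˡ p))
    at T F = refl
    at F T = cong (F ,_) (trans (label₀≡ F F ε) (sym (inverseˡ p)))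
    at T T = cong (F ,_) (label₀≡ F F p)

  ε≢p : ε ≢ p
  ε≢p = next-ε≢ε ∘ sym

  -- Both edges leaving the identity are loops fixed by `f`, so by injectivity no other edge enters
  -- the identity. `ℓ-identity` does the same for labels.
  f-identity : ∀ b → f (εG , b) ≡ (εG , b)
  f-identity F = trans (f-≢ ε≢p) (cong (λ s → (F , s) , F) (identityˡ ε))
  f-identity T = trans (f-site F T) (cong (λ s → (F , s) , T) (identityˡ ε))

  ℓ-identity : ∀ b → ℓ (εG , b) ≡ (εG , b)
  ℓ-identity F = cong ℓ₀ (exchange⁻¹-≢ ε≢p)
  ℓ-identity T = trans (ℓ-site F T) (cong (λ s → (F , s) , T) (inverseˡ p))

  edges : List Edge
  edges = cartesianProduct (cartesianProduct bools (allFin n)) bools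
    where
    bools = false ∷ true ∷ []

  complete : ∀ e → e ∈ edges
  complete ((a , s) , b) = ∈-cartesianProduct⁺ (∈-cartesianProduct⁺ (bool a) (∈-allFin s)) (bool b)
    where
    bool : ∀ b → b ∈ false ∷ true ∷ []
    bool F = here refl
    bool T = there (here refl)

  _≟E_ : DecidableEquality Edge
  _≟E_ = ≡-dec _≟G_ Bool._≟_

  _≈_ : Edge → Edge → Set
  e ≈ e′ = proj₁ e ≡ proj₁ e′

  ≈-isDecEquivalence : IsDecEquivalence _≈_
  ≈-isDecEquivalence = record
    { isEquivalence = record { refl = refl ; sym = sym ; trans = trans }
    ; _≟_ = λ e e′ → proj₁ e ≟G proj₁ e′
    }

  -- The circuit and its avoidance of the identity

  open Circuits edges complete (isDecEquivalence _≟E_) ≈-isDecEquivalence (cong proj₁) f (cong f) f-injective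

  start : Edge
  start = (T , ε) , F

  open Circuit (circuit start)

  C : List Edge
  C = start ∷ rest

  -- If the edge after `a` left the identity, `f a` would be one of the two fixed loops, and `a`
  -- would be that loop by injectivity.
  nonidentity : ∀ {a b} xs → Path a xs b → proj₁ a ≢ εG → ∀ {e} → e ∈ xs → proj₁ e ≢ εG
  nonidentity {a} (x ∷ xs) (s , q) a≢ = λ
    { (here refl) → x≢
    ; (there e∈) → nonidentity xs q x≢ e∈
    }
    where
    x≢ : proj₁ x ≢ εG
    x≢ x≡ = a≢ (cong proj₁ (f-injective {a} {εG , proj₂ (f a)}
      (trans (cong (_, proj₂ (f a)) (trans s x≡)) (sym (f-identity _)))))

  C-nonidentity : ∀ {e} → e ∈ C → proj₁ e ≢ εG
  C-nonidentity (here refl) ()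
  C-nonidentity (there e∈) = nonidentity rest path (λ ()) e∈

  C-unique : Unique C
  C-unique = distinct

  -- `f` maps the finite set of edges of `C` injectively into itself, hence onto itself. This lets
  -- edges be followed backwards.
  f-closed⁻¹ : ∀ {e} → f e ∈ C → e ∈ C
  f-closed⁻¹ {e} fe∈ with ∈-map⁻ f (unique⊆⇒⊇ _≟E_ (Unique.map⁺ f-injective C-unique) fC⊆C
                            (≤-reflexive (sym (length-map f C))) fe∈)
    where
    fC⊆C : map f C ⊆ C
    fC⊆C e∈ with ∈-map⁻ f e∈
    ... | _ , e′∈ , refl = f-closed e′∈
  ... | e′ , e′∈ , fe≡fe′ = subst (_∈ C) (sym (f-injective fe≡fe′)) e′∈

  -- Connectivity away from the identity

  Visited : Carrier → Set
  Visited g = (g , F) ∈ C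

  visited : ∀ {e} → e ∈ C → Visited (proj₁ e)
  visited e∈ = ≈-closed e∈ refl

  forth : ∀ e {g} → proj₁ (f e) ≡ g → Visited (proj₁ e) → Visited g
  forth e refl v = visited (f-closed (≈-closed {y = e} v refl))

  back : ∀ e {g} → proj₁ (f e) ≡ g → Visited g → Visited (proj₁ e)
  back e refl v = visited (f-closed⁻¹ (≈-closed {y = f e} v refl))

  target-≢ : ∀ {a s} b → s ≢ pivot a b → proj₁ (f ((a , s) , b)) ≡ (b , target₀ a b s)
  target-≢ b s≢ = cong proj₁ (f-≢ s≢)

  T⇒F² : ∀ {v} → v ≢ ε → Visited (T , v) → Visited (F , v ∙ v)
  T⇒F² v≢ = forth ((T , _) , F) (target-≢ F v≢)

  F²⇒T : ∀ {v} → v ≢ ε → Visited (F , v ∙ v) → Visited (T , v)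
  F²⇒T v≢ = back ((T , _) , F) (target-≢ F v≢)

  p-target : proj₁ (f ((F , p) , F)) ≡ (T , p)
  p-target = trans (cong proj₁ (f-site F F)) (cong (T ,_) (//-rightDividesˡ p p))

  -- For `v` other than `ε` and `p`, both (F , v) and (T , v) have an edge to (F , v²). For `p` this
  -- fails, but the exchanged edge joins (F , p) to (T , p) directly.
  F⇒T : ∀ {v} → v ≢ ε → Visited (F , v) → Visited (T , v)
  F⇒T {v} v≢ with v Fin.≟ p
  ... | yes refl = forth ((F , p) , F) p-target
  ... | no v≢p = F²⇒T v≢ ∘ forth ((F , v) , F) (target-≢ F v≢p)

  T⇒F : ∀ {v} → v ≢ ε → Visited (T , v) → Visited (F , v)
  T⇒F {v} v≢ with v Fin.≟ p
  ... | yes refl = back ((F , p) , F) p-target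
  ... | no v≢p = back ((F , v) , F) (target-≢ F v≢p) ∘ T⇒F² v≢

  -- The vertex (T , ε) stands in for the missing vertex (F , ε).
  Reached : A → Set
  Reached v = (v ≡ ε → Visited (T , ε)) × (v ≢ ε → Visited (F , v))

  reached-ε : Visited (T , ε) → Reached ε
  reached-ε v = (λ _ → v) , λ ε≢ε → contradiction refl ε≢ε

  reached-≢ : ∀ {v} → v ≢ ε → Visited (F , v) → Reached v
  reached-≢ v≢ v = (λ v≡ → contradiction v≡ v≢) , λ _ → v

  -- From (T , ε) an exchanged edge leads to (F , p²), whence to (T , p) and (F , p). From (F , v)
  -- with v ≢ ε an edge leads to (T , ν(v)²). This is (T , ε) if ν(v) = ε; otherwise the way goes on
  -- through (F , ν(v)²) and (T , ν(v)) to (F , ν(v)).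
  reached-next : ∀ {v} → Reached v → Reached (next v)
  reached-next {v} (v≡⇒ , v≢⇒) with v Fin.≟ ε
  ... | yes refl = reached-≢ next-ε≢ε (T⇒F next-ε≢ε (F²⇒T next-ε≢ε
          (forth ((T , ε) , F) (cong proj₁ (f-site T F)) (v≡⇒ refl))))
  ... | no v≢ with next v Fin.≟ ε | forth ((F , v) , T) (target-≢ T v≢) (v≢⇒ v≢)
  ...   | yes nv≡ε | v∈ = subst Reached (sym nv≡ε)
            (reached-ε (subst (λ s → Visited (T , s)) (trans (cong (λ s → s ∙ s) nv≡ε) (identityˡ ε)) v∈))
  ...   | no nv≢ | v∈ = reached-≢ nv≢ (T⇒F nv≢ (F²⇒T nv≢ (T⇒F nv²≢ v∈)))
    where
    nv²≢ : next v ∙ next v ≢ ε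
    nv²≢ eq = nv≢ (square-injective (trans eq (sym (identityˡ ε))))

  all-reached : ∀ v → Reached v
  all-reached = cyclic Reached (reached-ε (here refl)) reached-next

  all-visited : ∀ g → g ≢ εG → Visited g
  all-visited (F , v) g≢ = proj₂ (all-reached v) λ { refl → g≢ refl }
  all-visited (T , v) _ with v Fin.≟ ε
  ... | yes refl = proj₁ (all-reached ε) refl
  ... | no v≢ = F⇒T v≢ (proj₂ (all-reached v) v≢)

  all-edges : ∀ g → g ≢ εG → ∀ b → (g , b) ∈ C
  all-edges g g≢ b = ≈-closed (all-visited g g≢) refl

  -- Reading the sequence and its quotients off the circuit

  ℓ-nonidentity : ∀ {e} → e ∈ C → proj₁ (ℓ e) ≢ εG
  ℓ-nonidentity {e} e∈ ℓ≡ = C-nonidentity e∈ (cong proj₁ (ℓ-injective {e} {εG , proj₂ (ℓ e)}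
    (trans (cong (_, proj₂ (ℓ e)) ℓ≡) (sym (ℓ-identity _)))))

  ℓC-unique : Unique (map ℓ C)
  ℓC-unique = Unique.map⁺ ℓ-injective C-unique

  -- `C` consists of all pairs over nonidentity elements, and `ℓ` maps it injectively into itself,
  -- hence onto.
  C⊆ℓC : C ⊆ map ℓ C
  C⊆ℓC = unique⊆⇒⊇ _≟E_ ℓC-unique ℓC⊆C (≤-reflexive (sym (length-map ℓ C)))
    where
    ℓC⊆C : map ℓ C ⊆ C
    ℓC⊆C e∈ with ∈-map⁻ ℓ e∈
    ... | e′ , e′∈ , refl = all-edges _ (ℓ-nonidentity e′∈) _

  step-label : ∀ {e g} → proj₁ (f e) ≡ g → (proj₁ e ⁻¹G) ∙G g ≡ proj₁ (ℓ e)
  step-label {e} refl = quotient≡label e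

  -- The tail of each edge is the target of the edge before it, so consecutive quotients are labels.
  -- The quotient closing the cycle stands first, as in `check`, but is the label of the last edge;
  -- hence a permutation and a free end `b` for the induction.
  quotients-↭ : ∀ {a b} xs → Path a xs b →
    (lastOf (proj₁ a) (map proj₁ xs) ⁻¹G) ∙G proj₁ b
      ∷ zipWith (λ g h → (g ⁻¹G) ∙G h) (proj₁ a ∷ map proj₁ xs) (map proj₁ xs)
      ↭ map proj₁ (map ℓ (a ∷ xs))
  quotients-↭ [] q = ↭-reflexive (cong (_∷ []) (step-label q))
  quotients-↭ {a} (x ∷ xs) (s , q) = ↭-trans (swap _ _ ↭-refl) (↭-trans (prep _ (quotients-↭ xs q))
    (↭-reflexive (cong (_∷ map proj₁ (map ℓ (x ∷ xs))) (step-label {a} s))))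

  open Occurrences _≟G_

  doubly : (es : List Edge) → Unique es → (∀ {e} → e ∈ es → proj₁ e ≢ εG) →
    (∀ g → g ≢ εG → ∀ b → (g , b) ∈ es) → InP2∖1 _≟G_ εG (map proj₁ es)
  doubly es es! es≢ all∈ = occ-∉ _ ε∉ , λ g g≢ → occ-doubled es es! (all∈ g g≢)
    where
    ε∉ : εG ∉ map proj₁ es
    ε∉ ε∈ with ∈-map⁻ proj₁ ε∈
    ... | _ , e∈ , ε≡ = es≢ e∈ (sym ε≡)

  InP2∖1-resp-↭ : ∀ {gs hs} → gs ↭ hs → InP2∖1 _≟G_ εG hs → InP2∖1 _≟G_ εG gs
  InP2∖1-resp-↭ gs↭hs (zero≡ , two≡) =
    trans (occ-↭ _ gs↭hs) zero≡ , λ g g≢ → trans (occ-↭ g gs↭hs) (two≡ g g≢)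

  doublyRSequenceable : DoublyRSequenceable _≟G_ _∙G_ εG _⁻¹G
  doublyRSequenceable = map proj₁ C ,
    doubly C C-unique C-nonidentity all-edges ,
    InP2∖1-resp-↭ (quotients-↭ rest path)
      (doubly (map ℓ C) ℓC-unique ℓC≢ λ g g≢ b → C⊆ℓC (all-edges g g≢ b))
    where
    ℓC≢ : ∀ {e} → e ∈ map ℓ C → proj₁ e ≢ εG
    ℓC≢ e∈ with ∈-map⁻ ℓ e∈
    ... | _ , e′∈ , refl = ℓ-nonidentity e′∈

theorem2p1 : (n : ℕ) (H : FinGroup n) → 1 < n → Odd n →
    DoublyRSequenceable (Z2×._≟G_ H) (Z2×._∙_ H) (Z2×.ε H) (Z2×._⁻¹ H)
theorem2p1 n H (s≤s (s≤s z≤n)) odd =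
  Graph.doublyRSequenceable H harmoniousCycle (Squares.square-injective H odd) next-ε≢ε
  where
  open Harmony H
  open HarmoniousCycle harmoniousCycle

  next-ε≢ε : next ε ≢ ε
  -- If ν fixed `ε`, its cycle through `ε` would consist of `ε` alone, but there are at least two
  -- elements.
  next-ε≢ε next-ε≡ε = Fin.0≢1+n (trans (constant Fin.zero) (sym (constant (Fin.suc Fin.zero))))
    where
    constant : ∀ v → v ≡ ε
    constant = cyclic (_≡ ε) refl λ { refl → next-ε≡ε }
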